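{- Let $k\ge 4$ be an integer and let $\alpha=\alpha_k$ be the unique root in the interval $(3,4)$ of the equation $a=\left(1+\frac{a-2}{k+1}\right)^{k+1}$. Then the online algorithm $\mathrm{UNI}_k$ described in the context is $\frac1\alpha$-competitive for maximizing a non-negative monotone submodular function under a $k$-uniform matroid constraint with free disposal. That is, for every ground set $\Omega$, every non-negative monotone submodular $f:2^\Omega\to\mathbb{R}_+$ and every finite sequence of distinct elements of $\Omega$, the final set $S$ held by the algorithm satisfies $f(S)\ge\frac1\alpha f(\mathsf{OPT})$.
   Context: Write $S+a:=S\cup\{a\}$, $S-a:=S\setminus\{a\}$, $f(a|S):=f(S+a)-f(S)$; $f$ is monotone if $S\subseteq T$ implies $f(S)\le f(T)$. Online problem with free disposal ($k$-uniform matroid): elements of $\Omega$ arrive one by one in a finite sequence whose length is unknown to the algorithm. The algorithm maintains a set $S$, initially empty, with $|S|\le k$. In each round, when $u$ arrives, it may remove elements from $S$ and may include $u$ in $S$, provided $|S|\le k$ afterwards; rejected or removed elements cannot be retrieved. $f$ is accessed by a value oracle. $\mathsf{OPT}$ is a subset of at most $k$ elements of the sequence maximizing $f$. Notation: $A$ is the set of all elements that have ever been added to $S$ (possibly removed since). For an element $u$ of the sequence, $A(u)$ is the set $A$ at the beginning of the round in which $u$ arrives. Put $w(u):=f(u|A(u))$ and, for the current set $S$ and an element $v$, $w_S(v):=f(v|A(v)\cap S)$. For a weight function $\omega$ and a set $T$, $\omega(T):=\sum_{v\in T}\omega(v)$. Algorithm $\mathrm{UNI}_k$: start with $S=A=\varnothing$.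 When $u$ arrives: if $w(u)>\frac1k\left(\alpha\cdot w_S(S)-w(A)\right)$, then (i) if $|S|=k$, let $u'\in\arg\min_{v\in S}w_S(v)$ and set $S\leftarrow S-u'+u$; if $|S|<k$, set $S\leftarrow S+u$; and (ii) set $A\leftarrow A+u$. Otherwise discard $u$. -}

module Defs where

open import Level using (0ℓ) renaming (suc to lsuc)
open import Algebra.Bundles using (CommutativeRing; Semiring)
open import Data.List.Base using (List; []; _∷_; foldr; length; map)
open import Data.List.Membership.Propositional using () renaming (_∈_ to _∈ˡ_)
open import Data.List.Relation.Binary.Subset.Propositional using () renaming (_⊆_ to _⊆ˡ_)
open import Data.List.Relation.Unary.Any using (_─_)
open import Data.List.Relation.Unary.Unique.Propositional using (Unique)
open import Data.Nat.Base as ℕ using (ℕ)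
open import Data.Product using (_×_; ∃)
open import Relation.Binary.Bundles using (DecTotalOrder)
open import Relation.Binary.Core using (Rel)
open import Relation.Binary.Structures using (IsDecTotalOrder)
import Relation.Binary.Properties.DecTotalOrder as DecTotalOrderProperties
import Algebra.Definitions.RawSemiring as RawSemiringOperations
open import Relation.Nullary.Negation.Core using (¬_)
open import Relation.Binary.PropositionalEquality.Core using (_≡_)
open import Relation.Unary using (Pred; _∈_; _⊆_; _∪_; _∩_; ｛_｝; Satisfiable)

-- The real numbers, given by their classical axioms: a Dedekind-complete
-- totally ordered field.  These determine ℝ up to unique isomorphism.
record Reals : Set (lsuc 0ℓ) where
  infix  4 _≤_
  infix  8 _⁻¹
  field
    commutativeRing : CommutativeRing 0ℓ 0ℓ

  open CommutativeRing commutativeRing public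

  field
    _≤_             : Rel Carrier 0ℓ
    isDecTotalOrder : IsDecTotalOrder _≈_ _≤_
    0≉1             : ¬ (0# ≈ 1#)
    +-monoʳ-≤       : ∀ z {x y} → x ≤ y → z + x ≤ z + y
    *-nonNeg        : ∀ {x y} → 0# ≤ x → 0# ≤ y → 0# ≤ x * y
    -- Total, but specified only away from 0#.
    _⁻¹             : Carrier → Carrier
    *-inverseʳ      : ∀ {x} → ¬ (x ≈ 0#) → x * x ⁻¹ ≈ 1#

  _IsUpperBoundOf_ : Carrier → Pred Carrier 0ℓ → Set
  b IsUpperBoundOf P = ∀ {x} → x ∈ P → x ≤ b

  field
    complete : (P : Pred Carrier 0ℓ) → Satisfiable P → ∃ (_IsUpperBoundOf P) →
               ∃ λ s → s IsUpperBoundOf P × (∀ {b} → b IsUpperBoundOf P → s ≤ b)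

  decTotalOrder : DecTotalOrder 0ℓ 0ℓ 0ℓ
  decTotalOrder = record { isDecTotalOrder = isDecTotalOrder }

  -- x < y  unfolds to  x ≤ y × ¬ (x ≈ y).
  open DecTotalOrderProperties decTotalOrder public using (_<_)

  open RawSemiringOperations (Semiring.rawSemiring semiring) public using (_^_) renaming (_×_ to _·_)

  fromℕ : ℕ → Carrier
  fromℕ n = n · 1#

  ∑ : {A : Set} → (A → Carrier) → List A → Carrier
  ∑ ω T = foldr _+_ 0# (map ω T)

-- A list regarded as a set.
⟦_⟧ : {A : Set} → List A → Pred A 0ℓ
⟦ xs ⟧ = _∈ˡ xs

module _ (ℝ : Reals) where
  open Reals ℝ

  -- 2^Ω is Pred Ω 0ℓ.  Set functions are not explicitly required to respect
  -- extensional equality of predicates, since monotone ones do so by antisymmetry.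
  SetFunction : Set → Set₁
  SetFunction Ω = Pred Ω 0ℓ → Carrier

  module _ {Ω : Set} (f : SetFunction Ω) where

    NonNegative : Set₁
    NonNegative = ∀ S → 0# ≤ f S

    Monotone : Set₁
    Monotone = ∀ {S T} → S ⊆ T → f S ≤ f T

    Submodular : Set₁
    Submodular = ∀ S T → f (S ∪ T) + f (S ∩ T) ≤ f S + f T

    marginal : Ω → Pred Ω 0ℓ → Carrier
    marginal a S = f (S ∪ ｛ a ｝) - f S

    -- Lists without repetitions represent finite sets, so that length is cardinality.
    record Feasible (k : ℕ) (σ T : List Ω) : Set where
      field
        unique : Unique T
        subset : T ⊆ˡ σ
        size   : length T ℕ.≤ k

    IsOPT : ℕ → List Ω → List Ω → Set
    IsOPT k σ O = Feasible k σ O × (∀ T → Feasible k σ T → f ⟦ T ⟧ ≤ f ⟦ O ⟧)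

  -- An element v that has been added to S, together with A(v), the set A at
  -- the beginning of the round in which v arrived.
  record Arrival (Ω : Set) : Set where
    constructor _arrivedAt_
    field
      element : Ω
      before  : List Ω

  open Arrival

  elements : {Ω : Set} → List (Arrival Ω) → List Ω
  elements = map element

  module UNI {Ω : Set} (f : SetFunction Ω) (k : ℕ) (α : Carrier) where

    record State : Set where
      constructor ⟨_,_⟩
      field
        S : List (Arrival Ω)
        A : List (Arrival Ω)

    open State public

    w : Arrival Ω → Carrier
    w v = marginal f (element v) ⟦ before v ⟧

    wIn : List (Arrival Ω) → Arrival Ω → Carrier
    wIn S v = marginal f (element v) (⟦ before v ⟧ ∩ ⟦ elements S ⟧)

    arrive : Ω → State → Arrival Ω
    arrive u s = u arrivedAt elements (A s)

    Accepts : State → Arrival Ω → Set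
    Accepts s u = fromℕ k ⁻¹ * (α * ∑ (wIn (S s)) (S s) - ∑ w (A s)) < w u

    -- Ties in the choice of the removed element may be broken arbitrarily.
    data Step (u : Ω) (s : State) : State → Set where
      discard : ¬ Accepts s (arrive u s) →
                Step u s s
      add     : Accepts s (arrive u s) → length (S s) ℕ.< k →
                Step u s ⟨ arrive u s ∷ S s , arrive u s ∷ A s ⟩
      swap    : Accepts s (arrive u s) → length (S s) ≡ k →
                ∀ {u′} (u′∈S : u′ ∈ˡ S s) →
                (∀ {v} → v ∈ˡ S s → wIn (S s) u′ ≤ wIn (S s) v) →
                Step u s ⟨ arrive u s ∷ (S s ─ u′∈S) , arrive u s ∷ A s ⟩

    data Run (s : State) : List Ω → State → Set where
      []  : Run s [] s
      _∷_ : ∀ {u σ s′ s″} → Step u s s′ → Run s′ σ s″ → Run s (u ∷ σ) s″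

    start : State
    start = ⟨ [] , [] ⟩

  -- UNIₖ with parameter α is c-competitive.
  Competitive : ℕ → Carrier → Carrier → Set₁
  Competitive k α c =
    (Ω : Set) (f : SetFunction Ω) → NonNegative f → Monotone f → Submodular f →
    (σ : List Ω) → Unique σ →
    let open UNI f k α in
    (s : State) → Run start σ s →
    (O : List Ω) → IsOPT f k σ O →
    c * f ⟦ O ⟧ ≤ f ⟦ elements (S s) ⟧

  IsCriticalRoot : ℕ → Carrier → Set
  IsCriticalRoot k a =
    fromℕ 3 < a × a < fromℕ 4 ×
    a ≈ (1# + (a - fromℕ 2) * fromℕ (ℕ.suc k) ⁻¹) ^ ℕ.suc k

{-# OPTIONS --safe #-}
module Submission where

-- Competitiveness is a potential argument for Φ = α · w_S(S) - w(A), which is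
-- k times the acceptance threshold.  Suppose that Φ never decreases.  Then at
-- the end every element u of the sequence has f(u|A) ≤ Φ/k: an accepted
-- element has marginal 0, and a rejected one failed a threshold that has only
-- risen since, while its marginal has only fallen.  Adding the at most k
-- elements of OPT to A hence raises f by at most Φ (f-∪-≤), so
--   f(OPT) ≤ f(A) + Φ ≤ f(∅) + w(A) + Φ = f(∅) + α · w_S(S) ≤ α · f(S),
-- where f(S) ≥ f(∅) + w_S(S) telescopes along S (f[S]-lower).
--
-- The crux is that Φ never decreases, for which a swap has to satisfy
-- α · w_S(u′) ≤ (α - 1) · w(u).  Put γ = 1 + (α - 2)/(k + 1).  Then
-- k(γ - 1) = α - 1 - γ, and the equation for α says α = γ^(k+1).  This makes γ a
-- double root of the characteristic equation of the recurrence that the weights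
-- obey when each of them just meets the threshold.
-- This suggests the invariant
--   γ · s₁ + γ² · s₂ + γ³ · s₃ + ... ≤ Φ,
-- with s₁, s₂, ... the weights w_S listed from the newest member of S to the
-- oldest.  Accepting u multiplies the old sum by γ and adds γ · w_S(u); the
-- relation between k, γ and α makes the threshold pay for exactly this
-- (potential′).  On a swap, removing the minimum costs the sum at least γ^k
-- times that minimum whatever its position (geometricSum-─), as if the oldest
-- member had left, and γ · γ^k = α matches the loss in Φ.  Since all k weights
-- are at least the minimum, the invariant also bounds the minimum in terms of
-- Φ ≤ k · w(u), which gives the monotonicity of Φ (swap-loss).
--
-- For the root itself, the function (1 + (a - 2)/(k + 1))^(k + 1) - a is
-- negative at 3 and positive at 4, by second-order estimates of powers, and is
-- Lipschitz in between, so a supremum argument gives a zero.  On a ≥ 3 the base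
-- of the power is at least 1, which makes the function strictly increasing and
-- the zero unique.

open import Algebra.Bundles using (CommutativeRing)
import Algebra.Properties.Ring as RingProperties
import Algebra.Properties.Semiring.Exp as Exponentiation
import Algebra.Properties.Semiring.Mult.TCOptimised as Multiples
import Algebra.Solver.Ring as RingSolver
open import Algebra.Solver.Ring.AlmostCommutativeRing using (fromCommutativeRing; _-Raw-AlmostCommutative⟶_)
open import Data.Integer.Base as ℤ using (ℤ; +_; -[1+_]; _⊖_)
import Data.Integer.Properties as ℤ
open import Data.List.Base using (List; []; _∷_; length)
open import Data.List.Properties using (length-removeAt′)
open import Data.List.Membership.Propositional using () renaming (_∈_ to _∈ˡ_)
open import Data.List.Membership.Propositional.Properties using (∈-map⁻; ∈-map⁺)
open import Data.List.Relation.Binary.Subset.Propositional using () renaming (_⊆_ to _⊆ˡ_)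
open import Data.List.Relation.Unary.All as All using (All; []; _∷_)
import Data.List.Relation.Unary.All.Properties as All
open import Data.List.Relation.Unary.AllPairs using (AllPairs; []; _∷_)
open import Data.List.Relation.Unary.Any using (here; there; index; _─_)
open import Data.List.Relation.Unary.Unique.Propositional using (Unique)
open import Data.Maybe.Base as Maybe using (Maybe)
open import Data.Nat.Base as ℕ using (ℕ; zero; suc)
import Data.Nat.Properties as ℕ
open import Data.Product using (_×_; ∃!; ∃; _,_; proj₁; proj₂)
open import Data.Sum.Base using (inj₁; inj₂)
open import Function.Base using (case_of_)
open import Level using (0ℓ)
open import Relation.Binary.Bundles using (DecTotalOrder)
open import Relation.Binary.PropositionalEquality as ≡ using (_≡_)
import Relation.Binary.Construct.NonStrictToStrict as NonStrictToStrict
import Relation.Binary.Properties.DecTotalOrder as DecTotalOrderProperties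
import Relation.Binary.Reasoning.Setoid as SetoidReasoning
open import Relation.Nullary using (¬_; yes; no; contradiction)
open import Relation.Nullary.Decidable.Core using (dec⇒maybe)
open import Relation.Unary using (Pred; _∈_; _⊆_; _∪_; _∩_; ｛_｝)
open import Defs

-- Arithmetic in a commutative ring
module IntegerSolver {c ℓ} (R : CommutativeRing c ℓ) where
  open CommutativeRing R
  open RingProperties ring
  open Multiples semiring using (1+×; ×-homo-+; ×1-homo-*) renaming (_×_ to _·_)
  open SetoidReasoning setoid

  -- Ring normalisation with integer coefficients: zero coefficients have to be
  -- recognised for differences to cancel, and equality is decidable in ℤ.
  private
    ⟦_⟧ℤ : ℤ → Carrier
    ⟦ + n ⟧ℤ      = n · 1#
    ⟦ -[1+ n ] ⟧ℤ = - (suc n · 1#)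

    ⊖-homo : ∀ m n → ⟦ m ⊖ n ⟧ℤ ≈ m · 1# - n · 1#
    ⊖-homo m zero = begin
      m · 1#         ≈⟨ +-identityʳ _ ⟨
      m · 1# + 0#    ≈⟨ +-congˡ -0#≈0# ⟨
      m · 1# - 0#    ∎
    ⊖-homo zero (suc n) = sym (+-identityˡ _)
    ⊖-homo (suc m) (suc n) = begin
      ⟦ suc m ⊖ suc n ⟧ℤ                    ≡⟨ ≡.cong ⟦_⟧ℤ (ℤ.[1+m]⊖[1+n]≡m⊖n m n) ⟩
      ⟦ m ⊖ n ⟧ℤ                            ≈⟨ ⊖-homo m n ⟩
      m · 1# - n · 1#                       ≈⟨ +-congʳ (+-identityˡ _) ⟨
      0# + m · 1# - n · 1#                  ≈⟨ +-congʳ (+-congʳ (-‿inverseʳ 1#)) ⟨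
      1# - 1# + m · 1# - n · 1#             ≈⟨ +-congʳ (+-assoc _ _ _) ⟩
      1# + (- 1# + m · 1#) - n · 1#         ≈⟨ +-congʳ (+-congˡ (+-comm _ _)) ⟩
      1# + (m · 1# - 1#) - n · 1#           ≈⟨ +-congʳ (+-assoc _ _ _) ⟨
      1# + m · 1# - 1# - n · 1#             ≈⟨ +-assoc _ _ _ ⟩
      1# + m · 1# + (- 1# - n · 1#)         ≈⟨ +-congˡ (-‿+-comm 1# _) ⟩
      1# + m · 1# - (1# + n · 1#)           ≈⟨ +-cong (1+× m 1#) (-‿cong (1+× n 1#)) ⟨
      suc m · 1# - suc n · 1#               ∎

    +-homo : ∀ i j → ⟦ i ℤ.+ j ⟧ℤ ≈ ⟦ i ⟧ℤ + ⟦ j ⟧ℤ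
    +-homo (+ m) (+ n) = ×-homo-+ 1# m n
    +-homo (+ m) -[1+ n ] = ⊖-homo m (suc n)
    +-homo -[1+ m ] (+ n) = trans (⊖-homo n (suc m)) (+-comm _ _)
    +-homo -[1+ m ] -[1+ n ] = begin
      - (suc (suc (m ℕ.+ n)) · 1#)       ≡⟨ ≡.cong (λ l → - (suc l · 1#)) (ℕ.+-suc m n) ⟨
      - ((suc m ℕ.+ suc n) · 1#)         ≈⟨ -‿cong (×-homo-+ 1# (suc m) (suc n)) ⟩
      - (suc m · 1# + suc n · 1#)        ≈⟨ -‿+-comm _ _ ⟨
      - (suc m · 1#) - suc n · 1#        ∎

    -‿homo : ∀ i → ⟦ ℤ.- i ⟧ℤ ≈ - ⟦ i ⟧ℤ
    -‿homo (+ zero)  = sym -0#≈0#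
    -‿homo (+ suc n) = refl
    -‿homo -[1+ n ]  = sym (-‿involutive _)

    *-homo⁺ : ∀ m j → ⟦ + m ℤ.* j ⟧ℤ ≈ ⟦ + m ⟧ℤ * ⟦ j ⟧ℤ
    *-homo⁺ m (+ n) = trans (reflexive (≡.cong ⟦_⟧ℤ (≡.sym (ℤ.pos-* m n)))) (×1-homo-* m n)
    *-homo⁺ m -[1+ n ] = begin
      ⟦ + m ℤ.* -[1+ n ] ⟧ℤ              ≡⟨ ≡.cong ⟦_⟧ℤ (ℤ.neg-distribʳ-* (+ m) (+ suc n)) ⟨
      ⟦ ℤ.- (+ m ℤ.* + suc n) ⟧ℤ         ≈⟨ -‿homo (+ m ℤ.* + suc n) ⟩
      - ⟦ + m ℤ.* + suc n ⟧ℤ             ≈⟨ -‿cong (*-homo⁺ m (+ suc n)) ⟩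
      - (m · 1# * suc n · 1#)            ≈⟨ -‿distribʳ-* _ _ ⟩
      m · 1# * - (suc n · 1#)            ∎

    *-homo : ∀ i j → ⟦ i ℤ.* j ⟧ℤ ≈ ⟦ i ⟧ℤ * ⟦ j ⟧ℤ
    *-homo (+ m) j = *-homo⁺ m j
    *-homo -[1+ m ] j = begin
      ⟦ -[1+ m ] ℤ.* j ⟧ℤ                ≡⟨ ≡.cong ⟦_⟧ℤ (ℤ.neg-distribˡ-* (+ suc m) j) ⟨
      ⟦ ℤ.- (+ suc m ℤ.* j) ⟧ℤ           ≈⟨ -‿homo (+ suc m ℤ.* j) ⟩
      - ⟦ + suc m ℤ.* j ⟧ℤ               ≈⟨ -‿cong (*-homo⁺ (suc m) j) ⟩
      - (suc m · 1# * ⟦ j ⟧ℤ)            ≈⟨ -‿distribˡ-* _ _ ⟩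
      - (suc m · 1#) * ⟦ j ⟧ℤ            ∎

    homomorphism : ℤ.+-*-rawRing -Raw-AlmostCommutative⟶ fromCommutativeRing R
    homomorphism = record
      { ⟦_⟧    = ⟦_⟧ℤ
      ; +-homo = +-homo
      ; *-homo = *-homo
      ; -‿homo = -‿homo
      ; 0-homo = refl
      ; 1-homo = refl
      }

    _coeff≟_ : ∀ i j → Maybe (⟦ i ⟧ℤ ≈ ⟦ j ⟧ℤ)
    i coeff≟ j = Maybe.map (λ i≡j → reflexive (≡.cong ⟦_⟧ℤ i≡j)) (dec⇒maybe (i ℤ.≟ j))

  open RingSolver ℤ.+-*-rawRing (fromCommutativeRing R) homomorphism _coeff≟_ public
    using (solve; _:=_; _:+_; _:-_; _:*_; :-_; con; Polynomial)

  :0 :1 : ∀ {n} → Polynomial n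
  :0 = con (+ 0)
  :1 = con (+ 1)

-- Ordered fields
module OrderedField (ℝ : Reals) where
  open Reals ℝ
  open IntegerSolver commutativeRing public
  private module ≤ = DecTotalOrder decTotalOrder

  open DecTotalOrderProperties decTotalOrder public using (≤⇒≯; ≮⇒≥; ≰⇒>)

  <-≤-trans : ∀ {x y z} → x < y → y ≤ z → x < z
  <-≤-trans = NonStrictToStrict.<-≤-trans _≈_ _≤_ sym ≤.trans ≤.antisym ≤.≤-respʳ-≈

  infixl 6 _⊕_
  infixl 7 _⊗_

  -- Inequalities are proved from certificates: the difference of the two sides
  -- is written as a combination of products of nonnegative terms, most of them
  -- gaps of known inequalities.  The sum of ⊕ and ⊗ supplies the nonnegativity
  -- and the ring solver the identity, whose summands appear in the same order.
  gap : ∀ {x y} → x ≤ y → 0# ≤ y - x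
  gap {x} {y} x≤y = ≤.≤-respʳ-≈ (+-comm _ _) (≤.≤-respˡ-≈ (-‿inverseˡ x) (+-monoʳ-≤ (- x) x≤y))

  ≤-from : ∀ {x y e} → 0# ≤ e → y - x ≈ e → x ≤ y
  ≤-from {x} {y} {e} 0≤e y-x≈e = ≤.≤-respˡ-≈ (+-identityʳ x) (≤.≤-respʳ-≈ x+e≈y (+-monoʳ-≤ x 0≤e))
    where
    x+e≈y : x + e ≈ y
    x+e≈y = trans (+-congˡ (sym y-x≈e)) (solve 2 (λ x y → x :+ (y :- x) := y) refl x y)

  -- An equation contributes a term that is zero, with either sign according to
  -- its orientation; this is how hypotheses x ≈ y enter a certificate.
  gap-≈ : ∀ {x y} → x ≈ y → 0# ≤ y - x
  gap-≈ x≈y = gap (≤.reflexive x≈y)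

  _⊕_ : ∀ {x y} → 0# ≤ x → 0# ≤ y → 0# ≤ x + y
  _⊕_ {x} 0≤x 0≤y = ≤.trans 0≤x (≤.≤-respˡ-≈ (+-identityʳ x) (+-monoʳ-≤ x 0≤y))

  _⊗_ : ∀ {x y} → 0# ≤ x → 0# ≤ y → 0# ≤ x * y
  _⊗_ = *-nonNeg

  0≤1 : 0# ≤ 1#
  0≤1 with ≤.total 0# 1#
  ... | inj₁ 0≤1 = 0≤1
  ... | inj₂ 1≤0 = ≤-from (gap 1≤0 ⊗ gap 1≤0)
    (solve 0 (:1 :- :0 := (:0 :- :1) :* (:0 :- :1)) refl)

  0≤fromℕ : ∀ n → 0# ≤ fromℕ n
  0≤fromℕ zero    = ≤.refl
  0≤fromℕ (suc n) = 0≤1 ⊕ 0≤fromℕ n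

  fromℕ-mono : ∀ {m n} → m ℕ.≤ n → fromℕ m ≤ fromℕ n
  fromℕ-mono {n = n} ℕ.z≤n = 0≤fromℕ n
  fromℕ-mono (ℕ.s≤s m≤n) = +-monoʳ-≤ 1# (fromℕ-mono m≤n)

  0<⇒≉0 : ∀ {x} → 0# < x → ¬ x ≈ 0#
  0<⇒≉0 (_ , 0≉x) x≈0 = 0≉x (sym x≈0)

  0<1 : 0# < 1#
  0<1 = 0≤1 , 0≉1

  0<fromℕ : ∀ n → 0# < fromℕ (suc n)
  0<fromℕ n = <-≤-trans 0<1 (≤-from (0≤fromℕ n) (solve 1 (λ n → :1 :+ n :- :1 := n) refl (fromℕ n)))

  -- Were x ⁻¹ negative, then 1 = x · x ⁻¹ would be too.
  0≤⁻¹ : ∀ {x} → 0# < x → 0# ≤ x ⁻¹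
  0≤⁻¹ {x} 0<x@(0≤x , _) with ≤.total 0# (x ⁻¹)
  ... | inj₁ 0≤x⁻¹ = 0≤x⁻¹
  ... | inj₂ x⁻¹≤0 = contradiction 0<1 (≤⇒≯ (≤-from (0≤x ⊗ gap x⁻¹≤0)
    (trans (+-congˡ (-‿cong (sym (*-inverseʳ (0<⇒≉0 0<x)))))
           (solve 2 (λ x y → :0 :- x :* y := x :* (:0 :- y)) refl x (x ⁻¹)))))

  x*[x⁻¹*y]≈y : ∀ {x} → 0# < x → ∀ y → x * (x ⁻¹ * y) ≈ y
  x*[x⁻¹*y]≈y 0<x y = trans (sym (*-assoc _ _ _)) (trans (*-congʳ (*-inverseʳ (0<⇒≉0 0<x))) (*-identityˡ y))

  0<⁻¹ : ∀ {x} → 0# < x → 0# < x ⁻¹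
  0<⁻¹ {x} 0<x = 0≤⁻¹ 0<x , λ 0≈x⁻¹ → 0≉1
    (trans (sym (zeroʳ x)) (trans (*-congˡ 0≈x⁻¹) (*-inverseʳ (0<⇒≉0 0<x))))

  <-from : ∀ {x y e r} → 0# < e → 0# ≤ r → y - x ≈ e + r → x < y
  <-from {x} {y} {e} {r} 0<e 0≤r y-x≈e+r = x≤y , λ x≈y → ≤⇒≯
    (≤-from (0≤r ⊕ gap-≈ (sym x≈y) ⊕ gap-≈ (sym y-x≈e+r))
      (solve 4 (λ x y e r → :0 :- e := r :+ (x :- y) :+ (y :- x :- (e :+ r))) refl x y e r)) 0<e
    where x≤y = ≤-from (proj₁ 0<e ⊕ 0≤r) y-x≈e+r

  +-mono : ∀ {x y u v} → x ≤ y → u ≤ v → x + u ≤ y + v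
  +-mono {x} {y} {u} {v} x≤y u≤v = ≤-from (gap x≤y ⊕ gap u≤v)
    (solve 4 (λ x y u v → y :+ v :- (x :+ u) := y :- x :+ (v :- u)) refl x y u v)

  0<gap : ∀ {x y} → x < y → 0# < y - x
  0<gap {x} {y} (x≤y , x≉y) = gap x≤y , λ 0≈y-x → x≉y (begin
    x              ≈⟨ solve 2 (λ x y → x := y :- (y :- x)) refl x y ⟩
    y - (y - x)    ≈⟨ +-congˡ (-‿cong 0≈y-x) ⟨
    y - 0#         ≈⟨ solve 1 (λ y → y :- :0 := y) refl y ⟩
    y              ∎)
    where open SetoidReasoning setoid

  0<* : ∀ {x y} → 0# < x → 0# < y → 0# < x * y
  0<* {x} {y} 0<x@(0≤x , _) 0<y@(0≤y , 0≉y) = 0≤x ⊗ 0≤y , λ 0≈xy → 0≉y (sym (begin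
    y                  ≈⟨ *-identityˡ y ⟨
    1# * y             ≈⟨ *-congʳ (*-inverseʳ (0<⇒≉0 0<x)) ⟨
    x * x ⁻¹ * y       ≈⟨ solve 3 (λ x i y → x :* i :* y := i :* (x :* y)) refl x (x ⁻¹) y ⟩
    x ⁻¹ * (x * y)     ≈⟨ *-congˡ 0≈xy ⟨
    x ⁻¹ * 0#          ≈⟨ zeroʳ _ ⟩
    0#                 ∎))
    where open SetoidReasoning setoid

  0≤^ : ∀ {x} → 0# ≤ x → ∀ n → 0# ≤ x ^ n
  0≤^ 0≤x zero    = 0≤1
  0≤^ 0≤x (suc n) = 0≤x ⊗ 0≤^ 0≤x n

  ^-monoˡ-≤ : ∀ n {x y} → 0# ≤ x → x ≤ y → x ^ n ≤ y ^ n
  ^-monoˡ-≤ zero    0≤x x≤y = ≤.refl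
  ^-monoˡ-≤ (suc n) {x} {y} 0≤x x≤y = ≤-from
    (gap x≤y ⊗ 0≤^ (≤.trans 0≤x x≤y) n ⊕ 0≤x ⊗ gap (^-monoˡ-≤ n 0≤x x≤y))
    (solve 4 (λ x y p q → y :* q :- x :* p := (y :- x) :* q :+ x :* (q :- p)) refl x y (x ^ n) (y ^ n))

  ^-monoʳ-≤ : ∀ {x} → 1# ≤ x → ∀ {m n} → m ℕ.≤ n → x ^ m ≤ x ^ n
  ^-monoʳ-≤ {x} 1≤x {n = zero}  ℕ.z≤n = ≤.refl
  ^-monoʳ-≤ {x} 1≤x {n = suc n} ℕ.z≤n = ≤-from
    (gap 1≤x ⊗ 0≤^ (≤.trans 0≤1 1≤x) n ⊕ gap (^-monoʳ-≤ 1≤x {n = n} ℕ.z≤n))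
    (solve 2 (λ x p → x :* p :- :1 := (x :- :1) :* p :+ (p :- :1)) refl x (x ^ n))
  ^-monoʳ-≤ {x} 1≤x {suc m} {suc n} (ℕ.s≤s m≤n) = ≤-from
    (≤.trans 0≤1 1≤x ⊗ gap (^-monoʳ-≤ 1≤x m≤n))
    (solve 3 (λ x p q → x :* q :- x :* p := x :* (q :- p)) refl x (x ^ m) (x ^ n))

-- The root of the equation for α
module CriticalRoot (ℝ : Reals) where
  open Reals ℝ
  open OrderedField ℝ
  open RingProperties ring using (x∙y⁻¹≈ε⇒x≈y)
  open Exponentiation semiring using (^-congˡ)
  private module ≤ = DecTotalOrder decTotalOrder

  -- An intermediate value theorem.  The one-sided Lipschitz bound replaces
  -- continuity: it limits how fast h can rise, so h stays nonpositive a little to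
  -- the right of a negative value and is positive a little to the left of a
  -- positive one.
  module _ (h : Carrier → Carrier) {L p q} (0<L : 0# < L) (p≤q : p ≤ q)
    (lipschitz : ∀ {x y} → p ≤ x → x ≤ y → y ≤ q → h y ≤ h x + L * (y - x))
    (hp≤0 : h p ≤ 0#) (0<hq : 0# < h q) where
    private
      P : Pred Carrier 0ℓ
      P x = p ≤ x × x ≤ q × h x ≤ 0#

      module _ {s} (upper : s IsUpperBoundOf P) (least : ∀ {b} → b IsUpperBoundOf P → s ≤ b) where
        p≤s : p ≤ s
        p≤s = upper (≤.refl , p≤q , hp≤0)

        s≤q : s ≤ q
        s≤q = least λ (_ , x≤q , _) → x≤q

        -- If h s < 0, then h is still nonpositive at s + δ, contradicting that s is an
        -- upper bound, unless s + δ lies beyond q; then h q ≤ 0, contradicting 0 < h q.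
        0≤hs : 0# ≤ h s
        0≤hs with 0# ≤.≤? h s
        ... | yes 0≤hs = 0≤hs
        ... | no  0≰hs = contradiction 0<δ (≤⇒≯ δ≤0)
          where
          δ : Carrier
          δ = L ⁻¹ * (0# - h s)
          0<δ : 0# < δ
          0<δ = 0<* (0<⁻¹ 0<L) (0<gap (≰⇒> 0≰hs))
          below-zero : ∀ {y} → s ≤ y → y ≤ q → y ≤ s + δ → h y ≤ 0#
          below-zero {y} s≤y y≤q y≤s+δ = ≤-from
            (gap (lipschitz p≤s s≤y y≤q) ⊕ proj₁ 0<L ⊗ gap y≤s+δ ⊕ gap-≈ (x*[x⁻¹*y]≈y 0<L (0# - h s)))
            (solve 6 (λ hs hy l d y s → :0 :- hy :=
               (hs :+ l :* (y :- s) :- hy) :+ l :* (s :+ d :- y) :+ (:0 :- hs :- l :* d))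
               refl (h s) (h y) L δ y s)
          s≤s+δ : s ≤ s + δ
          s≤s+δ = ≤-from (proj₁ 0<δ) (solve 2 (λ s d → s :+ d :- s := d) refl s δ)
          δ≤0 : δ ≤ 0#
          δ≤0 with ≤.total (s + δ) q
          ... | inj₁ s+δ≤q = ≤-from
            (gap (upper (≤.trans p≤s s≤s+δ , s+δ≤q , below-zero s≤s+δ s+δ≤q ≤.refl)))
            (solve 2 (λ s d → :0 :- d := s :- (s :+ d)) refl s δ)
          ... | inj₂ q≤s+δ = contradiction 0<hq (≤⇒≯ (below-zero s≤q ≤.refl q≤s+δ))

        -- If h s > 0, then h cannot have climbed from a nonpositive value within
        -- distance δ, so s - δ is a smaller upper bound.
        hs≤0 : h s ≤ 0#
        hs≤0 with h s ≤.≤? 0#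
        ... | yes hs≤0 = hs≤0
        ... | no  hs≰0 = contradiction 0<δ (≤⇒≯ (≤-from (gap (least s-δ-upper))
          (solve 2 (λ s d → :0 :- d := s :- d :- s) refl s δ)))
          where
          δ : Carrier
          δ = L ⁻¹ * h s
          0<δ : 0# < δ
          0<δ = 0<* (0<⁻¹ 0<L) (≰⇒> hs≰0)
          s-δ-upper : (s - δ) IsUpperBoundOf P
          s-δ-upper {x} x∈P@(p≤x , x≤q , hx≤0) = ≤-from
            (0≤⁻¹ 0<L ⊗ (gap (lipschitz p≤x (upper x∈P) s≤q) ⊕ gap hx≤0) ⊕ gap-≈ (x*[x⁻¹*y]≈y 0<L (s - x)))
            (solve 6 (λ hs hx l i x s → s :- i :* hs :- x :=
               i :* ((hx :+ l :* (s :- x) :- hs) :+ (:0 :- hx)) :+ ((s :- x) :- l :* (i :* (s :- x))))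
               refl (h s) (h x) L (L ⁻¹) x s)

    root-of-Lipschitz : ∃ λ s → p ≤ s × s ≤ q × h s ≈ 0#
    root-of-Lipschitz
      with s , upper , least ← complete P (p , ≤.refl , p≤q , hp≤0) (q , λ (_ , x≤q , _) → x≤q)
      = s , p≤s upper least , s≤q upper least , ≤.antisym (hs≤0 upper least) (0≤hs upper least)

  -- The product rule, with y ^ n bounded by B ^ n, gives the recursion for L.
  ^-Lipschitz : ∀ {B} → 0# ≤ B → ∀ n → ∃ λ L → 0# ≤ L ×
    (∀ {x y} → 0# ≤ x → x ≤ y → y ≤ B → y ^ n ≤ x ^ n + L * (y - x))
  ^-Lipschitz 0≤B zero = 0# , ≤.refl , λ {x} {y} _ _ _ →
    ≤.reflexive (solve 2 (λ x y → :1 := :1 :+ :0 :* (y :- x)) refl x y)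
  ^-Lipschitz {B} 0≤B (suc n) with L , 0≤L , lipschitz ← ^-Lipschitz 0≤B n =
    B ^ n + B * L , 0≤^ 0≤B n ⊕ 0≤B ⊗ 0≤L , λ {x} {y} 0≤x x≤y y≤B → ≤-from
      (≤.trans 0≤x x≤y ⊗ gap (lipschitz 0≤x x≤y y≤B)
        ⊕ gap x≤y ⊗ gap (^-monoˡ-≤ n 0≤x (≤.trans x≤y y≤B))
        ⊕ gap y≤B ⊗ 0≤L ⊗ gap x≤y)
      (solve 7 (λ x y b l p q r → x :* p :+ (r :+ b :* l) :* (y :- x) :- y :* q :=
          y :* (p :+ l :* (y :- x) :- q) :+ (y :- x) :* (r :- p) :+ (b :- y) :* l :* (y :- x))
        refl x y B L (x ^ n) (y ^ n) (B ^ n))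

  -- Twice the first three binomial terms of (x + d)^(n+1), with the powers of x
  -- in the second and third replaced by 1.  For x = 1 it gives (1 + 2/N)^N > 4 for N ≥ 5;
  -- its quadratic term gives strict monotonicity of the function whose zero is α.
  ^-secondOrder-≥ : ∀ n {x d} → 1# ≤ x → 0# ≤ d → let N = fromℕ (suc n) in
    x ^ suc n + x ^ suc n + (N * d + N * d) + N * (fromℕ n * (d * d)) ≤ (x + d) ^ suc n + (x + d) ^ suc n
  ^-secondOrder-≥ zero {x} {d} _ _ = ≤.reflexive
    (solve 2 (λ x d → x :* :1 :+ x :* :1 :+ ((:1 :+ :0) :* d :+ (:1 :+ :0) :* d) :+ (:1 :+ :0) :* (:0 :* (d :* d))
        := (x :+ d) :* :1 :+ (x :+ d) :* :1) refl x d)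
  ^-secondOrder-≥ (suc n) {x} {d} 1≤x 0≤d = ≤-from
    ((0≤x ⊕ 0≤d) ⊗ gap (^-secondOrder-≥ n 1≤x 0≤d)
      ⊕ (0≤1 ⊕ 0≤1) ⊗ 0≤d ⊗ gap (^-monoʳ-≤ 1≤x (ℕ.z≤n {suc n}))
      ⊕ (0≤1 ⊕ 0≤1) ⊗ 0≤fromℕ (suc n) ⊗ 0≤d ⊗ gap 1≤x
      ⊕ 0≤fromℕ (suc n) ⊗ 0≤fromℕ n ⊗ (0≤d ⊗ 0≤d) ⊗ (gap 1≤x ⊕ 0≤d))
    (solve 5 (λ x d ν p q →
        let N = :1 :+ ν ; N′ = :1 :+ N ; :2 = :1 :+ :1 in
        (x :+ d) :* q :+ (x :+ d) :* q :- (x :* p :+ x :* p :+ (N′ :* d :+ N′ :* d) :+ N′ :* (N :* (d :* d)))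
        := (x :+ d) :* (q :+ q :- (p :+ p :+ (N :* d :+ N :* d) :+ N :* (ν :* (d :* d))))
           :+ :2 :* d :* (p :- :1) :+ :2 :* N :* d :* (x :- :1)
           :+ N :* ν :* (d :* d) :* (x :- :1 :+ d))
      refl x d (fromℕ n) (x ^ suc n) ((x + d) ^ suc n))
    where 0≤x = ≤.trans 0≤1 1≤x

  -- The remaining binomial terms are absorbed by doubling the quadratic one, as
  -- in exp t ≤ 1 + t + t² for t ≤ 1.  The bound is sharp enough for
  -- (1 + 1/N)^N ≤ 3 - 1/N.
  ^-secondOrder-≤ : ∀ n {x} → 0# ≤ x → fromℕ n * x ≤ 1# → let N = fromℕ (suc n) in
    (1# + x) ^ suc n ≤ 1# + N * x + N * (fromℕ n * (x * x))
  ^-secondOrder-≤ zero {x} _ _ = ≤.reflexive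
    (solve 1 (λ x → (:1 :+ x) :* :1 := :1 :+ (:1 :+ :0) :* x :+ (:1 :+ :0) :* (:0 :* (x :* x))) refl x)
  ^-secondOrder-≤ (suc n) {x} 0≤x Nx≤1 = ≤-from
    ((0≤1 ⊕ 0≤x) ⊗ gap (^-secondOrder-≤ n 0≤x νx≤1) ⊕ 0≤fromℕ (suc n) ⊗ (0≤x ⊗ 0≤x) ⊗ gap νx≤1)
    (solve 3 (λ x ν p →
        let N = :1 :+ ν ; N′ = :1 :+ N in
        :1 :+ N′ :* x :+ N′ :* (N :* (x :* x)) :- (:1 :+ x) :* p
        := (:1 :+ x) :* (:1 :+ N :* x :+ N :* (ν :* (x :* x)) :- p) :+ N :* (x :* x) :* (:1 :- ν :* x))
      refl x (fromℕ n) ((1# + x) ^ suc n))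
    where
    νx≤1 : fromℕ n * x ≤ 1#
    νx≤1 = ≤.trans (≤-from 0≤x (solve 2 (λ ν x → (:1 :+ ν) :* x :- ν :* x := x) refl (fromℕ n) x)) Nx≤1

  module _ (k : ℕ) (4≤k : 4 ℕ.≤ k) where
    private
      N κ c : Carrier
      N = fromℕ (suc k)
      κ = fromℕ k
      c = N ⁻¹

      0≤N : 0# ≤ N
      0≤N = 0≤fromℕ (suc k)

      Nc≈1 : N * c ≈ 1#
      Nc≈1 = *-inverseʳ (0<⇒≉0 (0<fromℕ k))

      0<c : 0# < c
      0<c = 0<⁻¹ (0<fromℕ k)

      base : Carrier → Carrier
      base a = 1# + (a - fromℕ 2) * c

      base-gap : ∀ x y → base y - base x ≈ (y - x) * c
      base-gap x y = solve 4 (λ x y t c →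
        :1 :+ (y :- t) :* c :- (:1 :+ (x :- t) :* c) := (y :- x) :* c) refl x y (fromℕ 2) c

      base-mono : ∀ {x y} → x ≤ y → base x ≤ base y
      base-mono {x} {y} x≤y = ≤-from (gap x≤y ⊗ proj₁ 0<c) (base-gap x y)

      excess : Carrier → Carrier
      excess a = base a ^ suc k - a

      excess-cong : ∀ {x y} → x ≈ y → excess x ≈ excess y
      excess-cong x≈y = +-cong (^-congˡ (suc k) (+-congˡ (*-congʳ (+-congʳ x≈y)))) (-‿cong x≈y)

      3≤4 : fromℕ 3 ≤ fromℕ 4
      3≤4 = fromℕ-mono {3} {4} (ℕ.s≤s (ℕ.s≤s (ℕ.s≤s ℕ.z≤n)))

      base-3 : base (fromℕ 3) ≈ 1# + c
      base-3 = solve 1 (λ c → let :2 = :1 :+ (:1 :+ :0) in :1 :+ (:1 :+ :2 :- :2) :* c := :1 :+ c) refl c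

      base-4 : base (fromℕ 4) ≈ 1# + (c + c)
      base-4 = solve 1 (λ c → let :2 = :1 :+ (:1 :+ :0) in :1 :+ (:1 :+ (:1 :+ :2) :- :2) :* c := :1 :+ (c :+ c)) refl c

      1≤base : ∀ {x} → fromℕ 3 ≤ x → 1# ≤ base x
      1≤base 3≤x = ≤.trans (≤-from (proj₁ 0<c) (solve 1 (λ c → :1 :+ c :- :1 := c) refl c))
        (≤.≤-respˡ-≈ base-3 (base-mono 3≤x))

      -- The hypothesis of the upper estimate at x = 1/N.
      κc≤1 : κ * c ≤ 1#
      κc≤1 = ≤.≤-respʳ-≈ Nc≈1 (≤-from (proj₁ 0<c)
        (solve 2 (λ κ c → (:1 :+ κ) :* c :- κ :* c := c) refl κ c))

      -- In terms of t = N c = 1, the upper estimate of (1 + c)^N is 3 - c.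
      excess-3 : excess (fromℕ 3) < 0#
      excess-3 = <-from 0<c
        (gap (≤.trans (≤.reflexive (^-congˡ (suc k) base-3)) (^-secondOrder-≤ k (proj₁ 0<c) κc≤1))
           ⊕ gap-≈ Nc≈1 ⊗ (0≤1 ⊕ 0≤1 ⊕ 0≤N ⊗ proj₁ 0<c) ⊕ gap-≈ (sym Nc≈1) ⊗ proj₁ 0<c)
        (solve 3 (λ κ c p → let N = :1 :+ κ ; t = N :* c in
             :0 :- (p :- (:1 :+ (:1 :+ (:1 :+ :0))))
             := c :+ (:1 :+ t :+ N :* (κ :* (c :* c)) :- p
                      :+ (:1 :- t) :* (:1 :+ :1 :+ t) :+ (t :- :1) :* c))
          refl κ c (base (fromℕ 3) ^ suc k))

      -- The lower estimate of 2 (1 + 2c)^N is 10 - 4c, and 5c ≤ 1 since N ≥ 5.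
      -- A nonpositive excess would therefore force c ≤ 0.
      excess-4 : 0# < excess (fromℕ 4)
      excess-4 = ≰⇒> λ excess≤0 → ≤⇒≯ (≤-from
        (gap excess≤0 ⊕ gap excess≤0
          ⊕ gap (≤.trans (^-secondOrder-≥ k ≤.refl (proj₁ 0<c ⊕ proj₁ 0<c)) (+-mono q≤ q≤))
          ⊕ (0≤1 ⊕ 0≤1) ⊗ gap (^-monoʳ-≤ ≤.refl (ℕ.z≤n {suc k}))
          ⊕ gap (fromℕ-mono (ℕ.s≤s 4≤k)) ⊗ proj₁ 0<c ⊕ gap-≈ Nc≈1 ⊕ 0≤1
          ⊕ gap-≈ (sym Nc≈1) ⊗ (0≤fromℕ 4 ⊗ (0≤N ⊗ proj₁ 0<c) ⊕ 0≤fromℕ 8)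
          ⊕ gap-≈ Nc≈1 ⊗ (0≤fromℕ 4 ⊗ proj₁ 0<c))
        (solve 4 (λ κ c p q → let
             N = :1 :+ κ ; t = N :* c ; d = c :+ c
             :4 = :1 :+ (:1 :+ (:1 :+ (:1 :+ :0)))
             :8 = :1 :+ (:1 :+ (:1 :+ (:1 :+ :4))) in
             :0 :- c
             := :0 :- (q :- :4) :+ (:0 :- (q :- :4))
                :+ (q :+ q :- (p :+ p :+ (N :* d :+ N :* d) :+ N :* (κ :* (d :* d))))
                :+ (:1 :+ :1) :* (p :- :1)
                :+ (N :- (:1 :+ :4)) :* c :+ (:1 :- t) :+ :1
                :+ (t :- :1) :* (:4 :* t :+ :8)
                :+ (:1 :- t) :* (:4 :* c))
          refl κ c (1# ^ suc k) (base (fromℕ 4) ^ suc k))) 0<c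
        where
        q≤ : (1# + (c + c)) ^ suc k ≤ base (fromℕ 4) ^ suc k
        q≤ = ≤.reflexive (^-congˡ (suc k) (sym base-4))

      -- The linear part of the excess only decreases, so L c would be a Lipschitz
      -- constant; the summand 1 makes it positive.
      excess-Lipschitz : ∃ λ L → 0# < L × (∀ {x y} → fromℕ 3 ≤ x → x ≤ y → y ≤ fromℕ 4 →
        excess y ≤ excess x + L * (y - x))
      excess-Lipschitz = from (^-Lipschitz (≤.trans 0≤1 (1≤base 3≤4)) (suc k))
        where
        from : (∃ λ L → 0# ≤ L × (∀ {x y} → 0# ≤ x → x ≤ y → y ≤ base (fromℕ 4) →
                  y ^ suc k ≤ x ^ suc k + L * (y - x))) → _
        from (L , 0≤L , lipschitz) = L * c + 1# ,
          <-from 0<1 (0≤L ⊗ proj₁ 0<c) (solve 1 (λ l → l :+ :1 :- :0 := :1 :+ l) refl (L * c)) ,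
          λ {x} {y} 3≤x x≤y y≤4 → ≤-from
            (gap (lipschitz (≤.trans 0≤1 (1≤base 3≤x)) (base-mono x≤y) (base-mono y≤4))
              ⊕ 0≤L ⊗ gap-≈ (base-gap x y) ⊕ gap x≤y ⊕ gap x≤y)
            (solve 8 (λ x y l c p q u v →
                p :- x :+ (l :* c :+ :1) :* (y :- x) :- (q :- y)
                := p :+ l :* (v :- u) :- q :+ l :* ((y :- x) :* c :- (v :- u)) :+ (y :- x) :+ (y :- x))
              refl x y L c (base x ^ suc k) (base y ^ suc k) (base x) (base y))

      root-exists : ∃ (IsCriticalRoot ℝ k)
      root-exists = from (root-of-Lipschitz excess (proj₁ (proj₂ excess-Lipschitz)) 3≤4
                      (proj₂ (proj₂ excess-Lipschitz)) (proj₁ excess-3) excess-4)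
        where
        from : (∃ λ a → fromℕ 3 ≤ a × a ≤ fromℕ 4 × excess a ≈ 0#) → _
        from (a , 3≤a , a≤4 , excess≈0)
          = a
          , (3≤a , λ 3≈a → proj₂ excess-3 (trans (excess-cong 3≈a) excess≈0))
          , (a≤4 , λ a≈4 → proj₂ excess-4 (trans (sym excess≈0) (excess-cong a≈4)))
          , sym (x∙y⁻¹≈ε⇒x≈y _ _ excess≈0)

      -- Raising a to b moves the base by d = (b - a) c, and the linear term N d of
      -- the estimate already matches the increase b - a.  The quadratic term is then
      -- a strict surplus, so the power at b exceeds b.
      no-larger-root : ∀ {a b} → IsCriticalRoot ℝ k a → IsCriticalRoot ℝ k b → ¬ a < b
      no-larger-root {a} {b} ((3≤a , _) , _ , a≈) (_ , _ , b≈) a<b =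
        ≤⇒≯
          (≤-from
            (0≤N ⊗ (gap (^-secondOrder-≥ k (1≤base 3≤a) (gap (proj₁ a<b) ⊗ proj₁ 0<c))
               ⊕ gap-≈ a≈ ⊕ gap-≈ a≈ ⊕ gap-≈ top ⊕ gap-≈ top
               ⊕ (gap-≈ (sym Nc≈1) ⊗ gap (proj₁ a<b) ⊕ gap-≈ (sym Nc≈1) ⊗ gap (proj₁ a<b)))
             ⊕ gap-≈ (sym Nc≈1) ⊗ (0≤N ⊗ proj₁ 0<c ⊕ 0≤1) ⊗ (0≤fromℕ k ⊗ (gap (proj₁ a<b) ⊗ gap (proj₁ a<b))))
            (solve 6 (λ κ c a b p q → let N = :1 :+ κ ; t = N :* c ; d = (b :- a) :* c in
              :0 :- κ :* ((b :- a) :* (b :- a))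
              := N :* (q :+ q :- (p :+ p :+ (N :* d :+ N :* d) :+ N :* (κ :* (d :* d)))
                  :+ (p :- a) :+ (p :- a) :+ (b :- q) :+ (b :- q)
                  :+ ((t :- :1) :* (b :- a) :+ (t :- :1) :* (b :- a)))
                 :+ (t :- :1) :* (t :+ :1) :* (κ :* ((b :- a) :* (b :- a))))
              refl κ c a b (base a ^ suc k) ((base a + (b - a) * c) ^ suc k)))
          (0<* 0<κ (0<* (0<gap a<b) (0<gap a<b)))
        where
        top : (base a + (b - a) * c) ^ suc k ≈ b
        top = trans (^-congˡ (suc k) (solve 4 (λ a b t c →
            :1 :+ (a :- t) :* c :+ (b :- a) :* c := :1 :+ (b :- t) :* c) refl a b (fromℕ 2) c)) (sym b≈)
        0<κ : 0# < κ
        0<κ = <-≤-trans (0<fromℕ 0) (fromℕ-mono (ℕ.≤-trans (ℕ.s≤s ℕ.z≤n) 4≤k))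

    criticalRoot-exists-unique : ∃! _≈_ (IsCriticalRoot ℝ k)
    criticalRoot-exists-unique = proj₁ root-exists , proj₂ root-exists , unique (proj₂ root-exists)
      where
      unique : ∀ {a b} → IsCriticalRoot ℝ k a → IsCriticalRoot ℝ k b → a ≈ b
      unique {a} {b} a-root b-root with a ≤.≟ b | ≤.total a b
      ... | yes a≈b | _ = a≈b
      ... | no  a≉b | inj₁ a≤b = contradiction (a≤b , a≉b) (no-larger-root a-root b-root)
      ... | no  a≉b | inj₂ b≤a = contradiction (b≤a , λ b≈a → a≉b (sym b≈a)) (no-larger-root b-root a-root)

-- Weighted lists
module _ {A : Set} where
  ─-⊆ : ∀ {x : A} {xs} (x∈xs : x ∈ˡ xs) → (xs ─ x∈xs) ⊆ˡ xs
  ─-⊆ (here _) v∈ = there v∈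
  ─-⊆ (there x∈xs) (here v≡) = here v≡
  ─-⊆ (there x∈xs) (there v∈) = there (─-⊆ x∈xs v∈)

  AllPairs-─ : ∀ {R : A → A → Set} {x xs} (x∈xs : x ∈ˡ xs) → AllPairs R xs → AllPairs R (xs ─ x∈xs)
  AllPairs-─ (here _) (_ ∷ rs) = rs
  AllPairs-─ (there x∈xs) (r ∷ rs) = All.─⁺ x∈xs r ∷ AllPairs-─ x∈xs rs

module WeightedLists (ℝ : Reals) where
  open Reals ℝ
  open OrderedField ℝ
  private module ≤ = DecTotalOrder decTotalOrder

  module _ {A : Set} where
    ∑-─ : ∀ (ω : A → Carrier) {x T} (x∈T : x ∈ˡ T) → ∑ ω T ≈ ω x + ∑ ω (T ─ x∈T)
    ∑-─ ω (here ≡.refl) = refl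
    ∑-─ ω {x} {v ∷ T} (there x∈T) = trans (+-congˡ (∑-─ ω x∈T))
      (solve 3 (λ v x t → v :+ (x :+ t) := x :+ (v :+ t)) refl (ω v) (ω x) (∑ ω (T ─ x∈T)))

    ∑-mono : ∀ {ω ω′ : A → Carrier} (T : List A) → (∀ {v} → v ∈ˡ T → ω v ≤ ω′ v) → ∑ ω T ≤ ∑ ω′ T
    ∑-mono [] _ = ≤.refl
    ∑-mono {ω} {ω′} (v ∷ T) ω≤ω′ = ≤-from
      (gap (ω≤ω′ (here ≡.refl)) ⊕ gap (∑-mono T (λ v∈T → ω≤ω′ (there v∈T))))
      (solve 4 (λ v v′ t t′ → v′ :+ t′ :- (v :+ t) := v′ :- v :+ (t′ :- t)) refl (ω v) (ω′ v) (∑ ω T) (∑ ω′ T))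

  module Geometric (γ : Carrier) (1≤γ : 1# ≤ γ) where
    private
      0≤γ : 0# ≤ γ
      0≤γ = ≤.trans 0≤1 1≤γ

    module _ {A : Set} where
      -- The sum of γ^i times the weight of the i-th entry, counted from 1, in Horner
      -- form.  On a list with the newest entry first, an entry gains a factor γ with
      -- every later arrival.
      geometricSum : (A → Carrier) → List A → Carrier
      geometricSum ω []      = 0#
      geometricSum ω (v ∷ T) = γ * (ω v + geometricSum ω T)

      0≤geometricSum : ∀ {ω : A → Carrier} → (∀ v → 0# ≤ ω v) → ∀ T → 0# ≤ geometricSum ω T
      0≤geometricSum 0≤ω []      = ≤.refl
      0≤geometricSum 0≤ω (v ∷ T) = 0≤γ ⊗ (0≤ω v ⊕ 0≤geometricSum 0≤ω T)

      -- The case of constant weights m is the closed form of the geometric series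
      -- γ + γ² + ..., multiplied by γ - 1 to avoid division.
      geometricSum-lower : ∀ {ω : A → Carrier} {m} T → (∀ {v} → v ∈ˡ T → m ≤ ω v) →
        (γ ^ suc (length T) - γ) * m ≤ (γ - 1#) * geometricSum ω T
      geometricSum-lower {m = m} [] _ = ≤.reflexive
        (solve 2 (λ l m → (l :* :1 :- l) :* m := (l :- :1) :* :0) refl γ m)
      geometricSum-lower {ω} {m} (v ∷ T) m≤ω = ≤-from
        (0≤γ ⊗ (gap 1≤γ ⊗ gap (m≤ω (here ≡.refl)) ⊕ gap (geometricSum-lower T (λ v∈T → m≤ω (there v∈T)))))
        (solve 5 (λ l m v g p →
            (l :- :1) :* (l :* (v :+ g)) :- (l :* p :- l) :* m
            := l :* ((l :- :1) :* (v :- m) :+ ((l :- :1) :* g :- (p :- l) :* m)))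
          refl γ m (ω v) (geometricSum ω T) (γ ^ suc (length T)))

      -- Removing x shifts all older entries down by one power of γ.  They weigh at
      -- least ω x, so the shift loses at least what moving x to the oldest position
      -- would have gained.
      geometricSum-─ : ∀ {ω : A → Carrier} {x T} (x∈T : x ∈ˡ T) → (∀ {v} → v ∈ˡ T → ω x ≤ ω v) →
        geometricSum ω (T ─ x∈T) + γ ^ length T * ω x ≤ geometricSum ω T
      geometricSum-─ {ω} {x} {_ ∷ T} (here ≡.refl) x≤ω = ≤-from
        (gap (geometricSum-lower T (λ v∈T → x≤ω (there v∈T))))
        (solve 4 (λ l x g p → l :* (x :+ g) :- (g :+ p :* x) := (l :- :1) :* g :- (p :- l) :* x)
          refl γ (ω x) (geometricSum ω T) (γ ^ suc (length T)))
      geometricSum-─ {ω} {x} {v ∷ T} (there x∈T) x≤ω = ≤-from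
        (0≤γ ⊗ gap (geometricSum-─ x∈T (λ v∈T → x≤ω (there v∈T))))
        (solve 6 (λ l x v g g′ p →
            l :* (v :+ g) :- (l :* (v :+ g′) :+ l :* p :* x) := l :* (g :- (g′ :+ p :* x)))
          refl γ (ω x) (ω v) (geometricSum ω T) (geometricSum ω (T ─ x∈T)) (γ ^ length T))

      -- No coefficient exceeds the last one, γ ^ length T.
      geometricSum-increase : ∀ {ω ω′ : A → Carrier} T → (∀ {v} → v ∈ˡ T → ω v ≤ ω′ v) →
        geometricSum ω′ T ≤ geometricSum ω T + γ ^ length T * (∑ ω′ T - ∑ ω T)
      geometricSum-increase [] _ = ≤.reflexive (solve 0 (:0 := :0 :+ :1 :* (:0 :- :0)) refl)
      geometricSum-increase {ω} {ω′} (v ∷ T) ω≤ω′ = ≤-from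
        (0≤γ ⊗ (gap (geometricSum-increase T (λ v∈T → ω≤ω′ (there v∈T)))
                ⊕ gap (^-monoʳ-≤ 1≤γ (ℕ.z≤n {length T})) ⊗ gap (ω≤ω′ (here ≡.refl))))
        (solve 8 (λ l v v′ g g′ s s′ p →
            l :* (v :+ g) :+ l :* p :* (v′ :+ s′ :- (v :+ s)) :- l :* (v′ :+ g′)
            := l :* (g :+ p :* (s′ :- s) :- g′ :+ (p :- :1) :* (v′ :- v)))
          refl γ (ω v) (ω′ v) (geometricSum ω T) (geometricSum ω′ T) (∑ ω T) (∑ ω′ T) (γ ^ length T))

-- Monotone submodular functions
module SubmodularFunctions (ℝ : Reals) {Ω : Set} (f : SetFunction ℝ Ω)
  (monotone : Monotone ℝ f) (submodular : Submodular ℝ f) where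
  open Reals ℝ
  open OrderedField ℝ
  private module ≤ = DecTotalOrder decTotalOrder

  0≤marginal : ∀ a S → 0# ≤ marginal ℝ f a S
  0≤marginal a S = gap (monotone inj₁)

  -- Submodularity for S + a and T.  If a already lies in T, then (S + a) ∩ T may
  -- be larger than S, and monotonicity makes up the difference; so no membership
  -- has to be decided.
  marginal-antitone : ∀ {a} {S T : Pred Ω 0ℓ} → S ⊆ T → marginal ℝ f a T ≤ marginal ℝ f a S
  marginal-antitone {a} {S} {T} S⊆T = ≤-from
    (gap (monotone {S} {S⁺ ∩ T} (λ s → inj₁ s , S⊆T s))
      ⊕ gap (submodular S⁺ T)
      ⊕ gap (monotone {T ∪ ｛ a ｝} {S⁺ ∪ T} λ { (inj₁ t) → inj₂ t ; (inj₂ ≡a) → inj₁ (inj₂ ≡a) }))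
    (solve 6 (λ s s⁺ t t⁺ i u →
        s⁺ :- s :- (t⁺ :- t) := i :- s :+ (s⁺ :+ t :- (u :+ i)) :+ (u :- t⁺))
      refl (f S) (f S⁺) (f T) (f (T ∪ ｛ a ｝)) (f (S⁺ ∩ T)) (f (S⁺ ∪ T)))
    where
    S⁺ : Pred Ω 0ℓ
    S⁺ = S ∪ ｛ a ｝

  marginal-member : ∀ {a} {S : Pred Ω 0ℓ} → a ∈ S → marginal ℝ f a S ≤ 0#
  marginal-member {a} {S} a∈S = ≤-from
    (gap (monotone {S ∪ ｛ a ｝} {S} λ { (inj₁ s) → s ; (inj₂ ≡.refl) → a∈S }))
    (solve 2 (λ s s⁺ → :0 :- (s⁺ :- s) := s :- s⁺) refl (f S) (f (S ∪ ｛ a ｝)))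

  -- The elements of T may be added one at a time, each gaining no more than over X.
  f-∪-≤ : ∀ {b} X T → (∀ {u} → u ∈ˡ T → marginal ℝ f u X ≤ b) →
    f (X ∪ ⟦ T ⟧) ≤ f X + fromℕ (length T) * b
  f-∪-≤ {b} X [] _ = ≤-from (gap (monotone {X ∪ ⟦ [] ⟧} {X} λ { (inj₁ x) → x ; (inj₂ ()) }))
    (solve 3 (λ b x y → x :+ :0 :* b :- y := x :- y) refl b (f X) (f (X ∪ ⟦ [] ⟧)))
  f-∪-≤ {b} X (u ∷ T) bound = ≤-from
    (gap (monotone {X ∪ ⟦ u ∷ T ⟧} {Y ∪ ｛ u ｝}
        λ { (inj₁ x) → inj₁ (inj₁ x)
          ; (inj₂ (here ≡.refl)) → inj₂ ≡.refl
          ; (inj₂ (there t)) → inj₁ (inj₂ t) })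
      ⊕ gap (marginal-antitone {u} {X} {Y} inj₁) ⊕ gap (bound (here ≡.refl))
      ⊕ gap (f-∪-≤ X T (λ u∈T → bound (there u∈T))))
    (solve 7 (λ b n x x⁺ y y⁺ z →
        x :+ (:1 :+ n) :* b :- z
        := y⁺ :- z :+ (x⁺ :- x :- (y⁺ :- y)) :+ (b :- (x⁺ :- x)) :+ (x :+ n :* b :- y))
      refl b (fromℕ (length T)) (f X) (f (X ∪ ｛ u ｝)) (f Y) (f (Y ∪ ｛ u ｝)) (f (X ∪ ⟦ u ∷ T ⟧)))
    where
    Y : Pred Ω 0ℓ
    Y = X ∪ ⟦ T ⟧

-- Analysis of the algorithm
module CompetitiveRatio (ℝ : Reals) where
  open Reals ℝ
  open OrderedField ℝ
  private module ≤ = DecTotalOrder decTotalOrder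

  module Analysis (k : ℕ) (0<k : 0 ℕ.< k) (α γ : Carrier)
    (1≤γ : 1# ≤ γ) (α≈γ^1+k : α ≈ γ ^ suc k) (rate : fromℕ k * (γ - 1#) ≈ α - 1# - γ)
    {Ω : Set} (f : SetFunction ℝ Ω) (nonNegative : NonNegative ℝ f) (monotone : Monotone ℝ f)
    (submodular : Submodular ℝ f) where

    open WeightedLists ℝ
    open Geometric γ 1≤γ
    open SubmodularFunctions ℝ f monotone submodular
    open UNI ℝ f k α
    open Arrival

    0<κ : 0# < fromℕ k
    0<κ = <-≤-trans (0<fromℕ 0) (fromℕ-mono 0<k)

    0≤γ : 0# ≤ γ
    0≤γ = ≤.trans 0≤1 1≤γ

    γ^≤α : ∀ {n} → n ℕ.≤ suc k → γ ^ n ≤ α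
    γ^≤α n≤1+k = ≤.≤-respʳ-≈ (sym α≈γ^1+k) (^-monoʳ-≤ 1≤γ n≤1+k)

    1≤α : 1# ≤ α
    1≤α = γ^≤α {0} ℕ.z≤n

    0≤α-1-γ : 0# ≤ α - 1# - γ
    0≤α-1-γ = ≤.≤-respʳ-≈ rate (proj₁ 0<κ ⊗ gap 1≤γ)

    Φ : State → Carrier
    Φ s = α * ∑ (wIn (S s)) (S s) - ∑ w (A s)

    threshold : State → Carrier
    threshold s = fromℕ k ⁻¹ * Φ s

    threshold≤⇒Φ≤ : ∀ s {b} → threshold s ≤ b → Φ s ≤ fromℕ k * b
    threshold≤⇒Φ≤ s {b} θ≤b = ≤-from (proj₁ 0<κ ⊗ gap θ≤b ⊕ gap-≈ (sym (x*[x⁻¹*y]≈y 0<κ (Φ s))))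
      (solve 4 (λ κ b t p → κ :* b :- p := κ :* (b :- t) :+ (κ :* t :- p)) refl (fromℕ k) b (threshold s) (Φ s))

    0≤w : ∀ v → 0# ≤ w v
    0≤w v = 0≤marginal (element v) ⟦ before v ⟧

    0≤wIn : ∀ T v → 0# ≤ wIn T v
    0≤wIn T v = 0≤marginal (element v) (⟦ before v ⟧ ∩ ⟦ elements ℝ T ⟧)

    -- The field ordered says that S is listed from newest to oldest: an older member was already
    -- in A when a newer one arrived.
    record Invariant (s : State) : Set where
      field
        S⊆A       : elements ℝ (S s) ⊆ˡ elements ℝ (A s)
        before⊆A  : ∀ {v} → v ∈ˡ S s → before v ⊆ˡ elements ℝ (A s)
        ordered   : AllPairs (λ v v′ → element v′ ∈ˡ before v) (S s)
        f[A]≤     : f ⟦ elements ℝ (A s) ⟧ ≤ f ⟦ [] ⟧ + ∑ w (A s)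
        potential : geometricSum (wIn (S s)) (S s) ≤ Φ s

    open Invariant

    record _↝_ (s s′ : State) : Set where
      field
        A-grows : elements ℝ (A s) ⊆ˡ elements ℝ (A s′)
        Φ-grows : Φ s ≤ Φ s′

    open _↝_

    ↝-refl : ∀ {s} → s ↝ s
    ↝-refl = record { A-grows = λ x → x ; Φ-grows = ≤.refl }

    ↝-trans : ∀ {s s′ s″} → s ↝ s′ → s′ ↝ s″ → s ↝ s″
    ↝-trans p q = record
      { A-grows = λ x → A-grows q (A-grows p x)
      ; Φ-grows = ≤.trans (Φ-grows p) (Φ-grows q)
      }

    0≤Φ : ∀ {s} → Invariant s → 0# ≤ Φ s
    0≤Φ {s} inv = ≤.trans (0≤geometricSum (0≤wIn (S s)) (S s)) (potential inv)

    0≤threshold : ∀ {s} → Invariant s → 0# ≤ threshold s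
    0≤threshold inv = 0≤⁻¹ 0<κ ⊗ 0≤Φ inv

    threshold-mono : ∀ {s s′} → s ↝ s′ → threshold s ≤ threshold s′
    threshold-mono {s} {s′} s↝s′ = ≤-from (0≤⁻¹ 0<κ ⊗ gap (Φ-grows s↝s′))
      (solve 3 (λ i p q → i :* q :- i :* p := i :* (q :- p)) refl (fromℕ k ⁻¹) (Φ s) (Φ s′))

    -- Build S up from its oldest member.  The members older than v lie both in S
    -- and in the set A(v), so by submodularity w_S(v) is at most the marginal of v
    -- over them.
    f[S]-lower : ∀ {s} → Invariant s → f ⟦ [] ⟧ + ∑ (wIn (S s)) (S s) ≤ f ⟦ elements ℝ (S s) ⟧
    f[S]-lower {s} inv = go (S s) (λ x → x) (ordered inv)
      where
      go : ∀ T → elements ℝ T ⊆ˡ elements ℝ (S s) → AllPairs (λ v v′ → element v′ ∈ˡ before v) T →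
           f ⟦ [] ⟧ + ∑ (wIn (S s)) T ≤ f ⟦ elements ℝ T ⟧
      go [] _ _ = ≤.reflexive (+-identityʳ _)
      go (v ∷ T) T⊆S (v> ∷ ord) = ≤-from
        (gap (go T (λ x → T⊆S (there x)) ord)
          ⊕ gap (marginal-antitone {element v} {⟦ elements ℝ T ⟧} {⟦ before v ⟧ ∩ ⟦ elements ℝ (S s) ⟧}
                  (λ x → earlier x , T⊆S (there x)))
          ⊕ gap (monotone {⟦ elements ℝ T ⟧ ∪ ｛ element v ｝} {⟦ elements ℝ (v ∷ T) ⟧}
                  λ { (inj₁ x) → there x ; (inj₂ ≡.refl) → here ≡.refl }))
        (solve 6 (λ e m t x y z →
            z :- (e :+ (m :+ t)) := x :- (e :+ t) :+ (y :- x :- m) :+ (z :- y))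
          refl (f ⟦ [] ⟧) (wIn (S s) v) (∑ (wIn (S s)) T) (f ⟦ elements ℝ T ⟧)
            (f (⟦ elements ℝ T ⟧ ∪ ｛ element v ｝)) (f ⟦ elements ℝ (v ∷ T) ⟧))
        where
        earlier : elements ℝ T ⊆ˡ before v
        earlier x∈ with v′ , v′∈T , ≡.refl ← ∈-map⁻ element x∈ = All.lookup v> v′∈T

    -- Addition and swap at once: u joins the survivors R of S, and m is the weight
    -- of the member that left, or 0 if none did.  The invariant needs from the
    -- departure only that it costs the geometric sum at least γ^k m.
    module Replacement {s : State} (inv : Invariant s) {u : Ω} (fresh : ¬ u ∈ˡ elements ℝ (A s))
      (accepted : Accepts s (arrive u s))
      (R : List (Arrival ℝ Ω)) (R⊆S : R ⊆ˡ S s)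
      (R-ordered : AllPairs (λ v v′ → element v′ ∈ˡ before v) R) (|R|<k : length R ℕ.< k)
      (m : Carrier)
      (∑-split : ∑ (wIn (S s)) (S s) ≈ m + ∑ (wIn (S s)) R)
      (geometricSum-split : geometricSum (wIn (S s)) R + γ ^ k * m ≤ geometricSum (wIn (S s)) (S s))
      (loss : α * m ≤ (α - 1#) * w (arrive u s))
      where
      û : Arrival ℝ Ω
      û = arrive u s

      s′ : State
      s′ = ⟨ û ∷ R , û ∷ A s ⟩

      elements-R⊆S : elements ℝ R ⊆ˡ elements ℝ (S s)
      elements-R⊆S x∈ with v , v∈R , ≡.refl ← ∈-map⁻ element x∈ = ∈-map⁺ element (R⊆S v∈R)

      -- The new element u arrived after v, so u is not in A(v) and S + u meets A(v)
      -- only inside the old S; fewer elements mean a larger marginal.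
      wIn-grows : ∀ {v} → v ∈ˡ R → wIn (S s) v ≤ wIn (S s′) v
      wIn-grows {v} v∈R = marginal-antitone λ where
        (x∈before , here ≡.refl) → contradiction (before⊆A inv (R⊆S v∈R) x∈before) fresh
        (x∈before , there x∈R)   → x∈before , elements-R⊆S x∈R

      w≤wIn : w û ≤ wIn (S s′) û
      w≤wIn = marginal-antitone proj₁

      Φ≤κw : Φ s ≤ fromℕ k * w û
      Φ≤κw = threshold≤⇒Φ≤ s (proj₁ accepted)

      0≤D : 0# ≤ ∑ (wIn (S s′)) R - ∑ (wIn (S s)) R
      0≤D = gap (∑-mono R wIn-grows)

      Φ≤Φ′ : Φ s ≤ Φ s′
      Φ≤Φ′ = ≤-from
        (0≤α ⊗ gap-≈ ∑-split ⊕ 0≤α ⊗ 0≤D ⊕ gap loss ⊕ 0≤α ⊗ gap w≤wIn)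
        (solve 8 (λ a x y m r r′ w w′ →
            a :* (w′ :+ r′) :- (w :+ y) :- (a :* x :- y)
            := a :* (m :+ r :- x) :+ a :* (r′ :- r) :+ ((a :- :1) :* w :- a :* m) :+ a :* (w′ :- w))
          refl α (∑ (wIn (S s)) (S s)) (∑ w (A s)) m (∑ (wIn (S s)) R) (∑ (wIn (S s′)) R) (w û) (wIn (S s′) û))
        where 0≤α = ≤.trans 0≤1 1≤α

      -- Survivors may gain weight, by D in total.  That raises Φ by α D, and γ times
      -- the geometric sum by at most α D, as their coefficients are at most
      -- γ^k.  The departure costs both sides α m = γ · γ^k m.  The weight of u
      -- in S may exceed w(u), which gains α in Φ and only γ in the sum.  What remains is
      -- γ · Φ + γ · w(u) ≤ Φ + (α - 1) w(u), which is Φ ≤ k · w(u)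
      -- multiplied by γ - 1, because k (γ - 1) = α - 1 - γ.
      potential′ : geometricSum (wIn (S s′)) (S s′) ≤ Φ s′
      potential′ = ≤-from
        (0≤γ ⊗ gap (geometricSum-increase R wIn-grows)
          ⊕ gap (γ^≤α (ℕ.m≤n⇒m≤1+n |R|<k)) ⊗ 0≤D
          ⊕ 0≤γ ⊗ (gap geometricSum-split ⊕ gap (potential inv))
          ⊕ gap-≈ α-split ⊕ 0≤α ⊗ gap-≈ ∑-split
          ⊕ (0≤α-1-γ ⊕ 0≤1) ⊗ gap w≤wIn
          ⊕ gap 1≤γ ⊗ gap Φ≤κw
          ⊕ gap-≈ (*-congʳ rate))
        (identity α γ (fromℕ k) (∑ (wIn (S s)) (S s)) (∑ w (A s)) m (∑ (wIn (S s)) R) (∑ (wIn (S s′)) R)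
          (w û) (wIn (S s′) û) (geometricSum (wIn (S s)) (S s)) (geometricSum (wIn (S s)) R)
          (geometricSum (wIn (S s′)) R) (γ ^ length R) (γ ^ k))
        where
        0≤α = ≤.trans 0≤1 1≤α
        α-split : α * m ≈ γ ^ suc k * m
        α-split = *-congʳ α≈γ^1+k
        identity : ∀ a l κ x y m r r′ w w′ g h h′ p q →
          a * (w′ + r′) - (w + y) - l * (w′ + h′)
          ≈ l * (h + p * (r′ - r) - h′)
            + (a - l * p) * (r′ - r)
            + l * (g - (h + q * m) + (a * x - y - g))
            + (l * q * m - a * m) + a * (m + r - x)
            + (a - 1# - l + 1#) * (w′ - w)
            + (l - 1#) * (κ * w - (a * x - y))
            + ((a - 1# - l) * w - κ * (l - 1#) * w)
        identity = solve 15 (λ a l κ x y m r r′ w w′ g h h′ p q →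
          a :* (w′ :+ r′) :- (w :+ y) :- l :* (w′ :+ h′)
          := l :* (h :+ p :* (r′ :- r) :- h′)
            :+ (a :- l :* p) :* (r′ :- r)
            :+ l :* (g :- (h :+ q :* m) :+ (a :* x :- y :- g))
            :+ (l :* q :* m :- a :* m) :+ a :* (m :+ r :- x)
            :+ (a :- :1 :- l :+ :1) :* (w′ :- w)
            :+ (l :- :1) :* (κ :* w :- (a :* x :- y))
            :+ ((a :- :1 :- l) :* w :- κ :* (l :- :1) :* w)) refl

      preserved : Invariant s′
      preserved = record
        { S⊆A       = λ where
            (here x≡u)  → here x≡u
            (there x∈R) → there (S⊆A inv (elements-R⊆S x∈R))
        ; before⊆A  = λ where
            (here ≡.refl) x∈before → there x∈before
            (there v∈R)   x∈before → there (before⊆A inv (R⊆S v∈R) x∈before)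
        ; ordered   = All.tabulate (λ v∈R → S⊆A inv (∈-map⁺ element (R⊆S v∈R))) ∷ R-ordered
        ; f[A]≤     = ≤-from
            (gap (f[A]≤ inv)
              ⊕ gap (monotone {⟦ elements ℝ (û ∷ A s) ⟧} {⟦ elements ℝ (A s) ⟧ ∪ ｛ u ｝}
                      λ { (here ≡.refl) → inj₂ ≡.refl ; (there x) → inj₁ x }))
            (solve 5 (λ e y a a⁺ b →
                e :+ (a⁺ :- a :+ y) :- b := e :+ y :- a :+ (a⁺ :- b))
              refl (f ⟦ [] ⟧) (∑ w (A s)) (f ⟦ elements ℝ (A s) ⟧)
                (f (⟦ elements ℝ (A s) ⟧ ∪ ｛ u ｝)) (f ⟦ elements ℝ (û ∷ A s) ⟧))
        ; potential = potential′
        }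

      evolves : s ↝ s′
      evolves = record { A-grows = there ; Φ-grows = Φ≤Φ′ }

    -- All k weights are at least m, so the invariant gives
    -- (α - γ) m ≤ (γ - 1) Φ ≤ (γ - 1) k · w(u) = (α - 1 - γ) w(u).  In particular
    -- m ≤ w(u), and adding γ m ≤ γ · w(u) yields the claim.
    swap-loss : ∀ {s u} → Invariant s → Accepts s (arrive u s) → length (S s) ≡ k →
      ∀ {u′} → (∀ {v} → v ∈ˡ S s → wIn (S s) u′ ≤ wIn (S s) v) →
      α * wIn (S s) u′ ≤ (α - 1#) * w (arrive u s)
    swap-loss {s} {u} inv accepted |S|≡k {u′} minimal = ≤-from
      (gap α-γ-loss ⊕ 0≤γ ⊗ gap m≤w)
      (solve 4 (λ a l m w →
          (a :- :1) :* w :- a :* m := (a :- :1 :- l) :* w :- (a :- l) :* m :+ l :* (w :- m))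
        refl α γ m (w û))
      where
      û : Arrival ℝ Ω
      û = arrive u s
      m : Carrier
      m = wIn (S s) u′

      lower : (α - γ) * m ≤ (γ - 1#) * geometricSum (wIn (S s)) (S s)
      lower = ≤.≤-respˡ-≈ (*-congʳ (+-congʳ (trans (reflexive (≡.cong (λ n → γ ^ suc n) |S|≡k)) (sym α≈γ^1+k))))
        (geometricSum-lower (S s) minimal)

      α-γ-loss : (α - γ) * m ≤ (α - 1# - γ) * w û
      α-γ-loss = ≤-from
        (gap lower ⊕ gap 1≤γ ⊗ (gap (potential inv) ⊕ gap (threshold≤⇒Φ≤ s (proj₁ accepted)))
          ⊕ gap-≈ (*-congʳ rate))
        (solve 7 (λ a l κ m w g p →
            (a :- :1 :- l) :* w :- (a :- l) :* m
            := (l :- :1) :* g :- (a :- l) :* m :+ (l :- :1) :* (p :- g :+ (κ :* w :- p))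
               :+ ((a :- :1 :- l) :* w :- κ :* (l :- :1) :* w))
          refl α γ (fromℕ k) m (w û) (geometricSum (wIn (S s)) (S s)) (Φ s))

      -- If w(u) ≤ m, α-γ-loss leaves m ≤ 0, and marginals are
      -- nonnegative.
      m≤w : m ≤ w û
      m≤w with ≤.total m (w û)
      ... | inj₁ m≤w = m≤w
      ... | inj₂ w≤m = ≤.trans
        (≤-from (gap α-γ-loss ⊕ 0≤α-1-γ ⊗ gap w≤m)
          (solve 4 (λ a l m w →
              :0 :- m := (a :- :1 :- l) :* w :- (a :- l) :* m :+ (a :- :1 :- l) :* (m :- w))
            refl α γ m (w û)))
        (0≤w û)

    start-invariant : Invariant start
    start-invariant = record
      { S⊆A       = λ ()
      ; before⊆A  = λ ()
      ; ordered   = []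
      ; f[A]≤     = ≤.reflexive (sym (+-identityʳ _))
      ; potential = ≤.reflexive (solve 1 (λ a → :0 := a :* :0 :- :0) refl α)
      }

    -- The last component, that u gains at most the threshold over A, is what the
    -- comparison with OPT uses.
    step-preserves : ∀ {u s s′} → Step u s s′ → ¬ u ∈ˡ elements ℝ (A s) → Invariant s →
      Invariant s′ × s ↝ s′ × elements ℝ (A s′) ⊆ˡ u ∷ elements ℝ (A s) ×
      marginal ℝ f u ⟦ elements ℝ (A s′) ⟧ ≤ threshold s′
    step-preserves {u} {s} (discard ¬accepted) fresh inv = inv , ↝-refl , there , ≮⇒≥ ¬accepted
    step-preserves {u} {s} (add accepted |S|<k) fresh inv =
      preserved , evolves , (λ x → x) , ≤.trans (marginal-member (here ≡.refl)) (0≤threshold preserved)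
      where
      open Replacement inv fresh accepted (S s) (λ x → x) (ordered inv) |S|<k 0#
        (sym (+-identityˡ _))
        (≤.reflexive (trans (+-congˡ (zeroʳ _)) (+-identityʳ _)))
        (≤.≤-respˡ-≈ (sym (zeroʳ _)) (gap 1≤α ⊗ 0≤w (arrive u s)))
    step-preserves {u} {s} (swap accepted |S|≡k {u′} u′∈S minimal) fresh inv =
      preserved , evolves , (λ x → x) , ≤.trans (marginal-member (here ≡.refl)) (0≤threshold preserved)
      where
      open Replacement inv fresh accepted (S s ─ u′∈S) (─-⊆ u′∈S) (AllPairs-─ u′∈S (ordered inv))
        (ℕ.≤-reflexive (≡.trans (≡.sym (length-removeAt′ (S s) (index u′∈S))) |S|≡k)) (wIn (S s) u′)
        (∑-─ (wIn (S s)) u′∈S)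
        (≡.subst (λ n → geometricSum (wIn (S s)) (S s ─ u′∈S) + γ ^ n * wIn (S s) u′ ≤ geometricSum (wIn (S s)) (S s))
          |S|≡k (geometricSum-─ u′∈S minimal))
        (swap-loss inv accepted |S|≡k {u′} minimal)

    run-preserves : ∀ {s σ s″} → Run s σ s″ → Unique σ → All (λ u → ¬ u ∈ˡ elements ℝ (A s)) σ →
      Invariant s →
      Invariant s″ × s ↝ s″ × (∀ {u} → u ∈ˡ σ → marginal ℝ f u ⟦ elements ℝ (A s″) ⟧ ≤ threshold s″)
    run-preserves [] _ _ inv = inv , ↝-refl , λ ()
    run-preserves {s} {u ∷ σ} {s″} (_∷_ {s′ = s′} step run) (u≢ ∷ unique) (fresh ∷ freshs) inv =
      continue (step-preserves step fresh inv)
      where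
      continue : Invariant s′ × s ↝ s′ × elements ℝ (A s′) ⊆ˡ u ∷ elements ℝ (A s) ×
        marginal ℝ f u ⟦ elements ℝ (A s′) ⟧ ≤ threshold s′ → _
      continue (inv′ , s↝s′ , A′⊆ , u≤) = finish (run-preserves run unique freshs′ inv′)
        where
        freshs′ : All (λ v → ¬ v ∈ˡ elements ℝ (A s′)) σ
        freshs′ = All.zipWith (λ (u≢v , v∉A) v∈A′ → case A′⊆ v∈A′ of λ where
          (here v≡u)  → u≢v (≡.sym v≡u)
          (there v∈A) → v∉A v∈A) (u≢ , freshs)
        finish : Invariant s″ × s′ ↝ s″ × (∀ {v} → v ∈ˡ σ → marginal ℝ f v ⟦ elements ℝ (A s″) ⟧ ≤ threshold s″) → _
        finish (inv″ , s′↝s″ , σ≤) = inv″ , ↝-trans s↝s′ s′↝s″ , λ where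
          (here ≡.refl) → ≤.trans (marginal-antitone (A-grows s′↝s″)) (≤.trans u≤ (threshold-mono s′↝s″))
          (there v∈σ)   → σ≤ v∈σ

    -- Since k · threshold = Φ, the w(A) in the bound on f(A) cancels against the one in
    -- Φ, leaving f(∅) + α · w_S(S).
    f[O]≤αf[S] : ∀ {s σ O} → Invariant s →
      (∀ {u} → u ∈ˡ σ → marginal ℝ f u ⟦ elements ℝ (A s) ⟧ ≤ threshold s) →
      Feasible ℝ f k σ O → f ⟦ O ⟧ ≤ α * f ⟦ elements ℝ (S s) ⟧
    f[O]≤αf[S] {s} {σ} {O} inv bounded feasible = ≤-from
      (gap (monotone {⟦ O ⟧} {⟦ elements ℝ (A s) ⟧ ∪ ⟦ O ⟧} inj₂)
        ⊕ gap (f-∪-≤ ⟦ elements ℝ (A s) ⟧ O (λ u∈O → bounded (subset u∈O)))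
        ⊕ gap (fromℕ-mono size) ⊗ 0≤threshold inv
        ⊕ gap-≈ (x*[x⁻¹*y]≈y 0<κ (Φ s))
        ⊕ gap (f[A]≤ inv)
        ⊕ gap 1≤α ⊗ nonNegative ⟦ [] ⟧
        ⊕ ≤.trans 0≤1 1≤α ⊗ gap (f[S]-lower inv))
      (solve 11 (λ a κ n θ o a∪o fA fS e x y →
          a :* fS :- o
          := a∪o :- o :+ (fA :+ n :* θ :- a∪o) :+ (κ :- n) :* θ
             :+ (a :* x :- y :- κ :* θ) :+ (e :+ y :- fA) :+ (a :- :1) :* e :+ a :* (fS :- (e :+ x)))
        refl α (fromℕ k) (fromℕ (length O)) (threshold s) (f ⟦ O ⟧) (f (⟦ elements ℝ (A s) ⟧ ∪ ⟦ O ⟧))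
          (f ⟦ elements ℝ (A s) ⟧) (f ⟦ elements ℝ (S s) ⟧) (f ⟦ [] ⟧) (∑ (wIn (S s)) (S s)) (∑ w (A s)))
      where open Feasible feasible

  competitive : ∀ k → 0 ℕ.< k → ∀ {α} → IsCriticalRoot ℝ k α → Competitive ℝ k α (α ⁻¹)
  competitive k 0<k {α} ((3≤α , _) , _ , α≈) Ω f nonNegative monotone submodular σ unique s run O (feasible , _)
    = bound (run-preserves run unique (All.tabulate λ _ ()) start-invariant)
    where
    N γ : Carrier
    N = fromℕ (suc k)
    γ = 1# + (α - fromℕ 2) * N ⁻¹

    NN⁻¹≈1 : N * N ⁻¹ ≈ 1#
    NN⁻¹≈1 = *-inverseʳ (0<⇒≉0 (0<fromℕ k))

    1≤γ : 1# ≤ γ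
    1≤γ = ≤-from ((gap 3≤α ⊕ 0≤1) ⊗ 0≤⁻¹ (0<fromℕ k))
      (solve 2 (λ a c → let :2 = :1 :+ (:1 :+ :0) in
          :1 :+ (a :- :2) :* c :- :1 := (a :- (:1 :+ :2) :+ :1) :* c) refl α (N ⁻¹))

    rate : fromℕ k * (γ - 1#) ≈ α - 1# - γ
    rate = begin
      fromℕ k * (γ - 1#)
        ≈⟨ solve 3 (λ κ a c → let :2 = :1 :+ (:1 :+ :0) in
             κ :* (:1 :+ (a :- :2) :* c :- :1) := (a :- :2) :* ((:1 :+ κ) :* c) :- (a :- :2) :* c)
             refl (fromℕ k) α (N ⁻¹) ⟩
      (α - fromℕ 2) * (N * N ⁻¹) - (α - fromℕ 2) * N ⁻¹
        ≈⟨ +-congʳ (*-congˡ NN⁻¹≈1) ⟩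
      (α - fromℕ 2) * 1# - (α - fromℕ 2) * N ⁻¹
        ≈⟨ solve 2 (λ a c → let :2 = :1 :+ (:1 :+ :0) in
             (a :- :2) :* :1 :- (a :- :2) :* c := a :- :1 :- (:1 :+ (a :- :2) :* c)) refl α (N ⁻¹) ⟩
      α - 1# - γ ∎
      where open SetoidReasoning setoid

    open Analysis k 0<k α γ 1≤γ α≈ rate f nonNegative monotone submodular

    0<α : 0# < α
    0<α = <-≤-trans 0<1 1≤α

    bound : Invariant s × UNI.start ℝ f k α ↝ s ×
      (∀ {u} → u ∈ˡ σ → marginal ℝ f u ⟦ elements ℝ (UNI.A s) ⟧ ≤ threshold s) →
      α ⁻¹ * f ⟦ O ⟧ ≤ f ⟦ elements ℝ (UNI.S s) ⟧
    bound (inv , _ , bounded) = ≤-from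
      (0≤⁻¹ 0<α ⊗ gap (f[O]≤αf[S] inv bounded feasible) ⊕ gap-≈ (x*[x⁻¹*y]≈y 0<α (f ⟦ elements ℝ (UNI.S s) ⟧)))
      (solve 4 (λ a i o s → s :- i :* o := i :* (a :* s :- o) :+ (s :- a :* (i :* s)))
        refl α (α ⁻¹) (f ⟦ O ⟧) (f ⟦ elements ℝ (UNI.S s) ⟧))

theorem3p1 : (ℝ : Reals) (k : ℕ) → 4 ℕ.≤ k →
    ∃! (Reals._≈_ ℝ) (IsCriticalRoot ℝ k) ×
    ((α : Reals.Carrier ℝ) → IsCriticalRoot ℝ k α → Competitive ℝ k α (Reals._⁻¹ ℝ α))
theorem3p1 ℝ k 4≤k = CriticalRoot.criticalRoot-exists-unique ℝ k 4≤k ,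
  λ α → CompetitiveRatio.competitive ℝ k (ℕ.≤-trans (ℕ.s≤s ℕ.z≤n) 4≤k)
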